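{- Let $P=\varprojlim\langle\{P_n\},\{p^n_k\}_{k<n}\rangle$ and $H=\varprojlim\langle\{H_n\},\{h^n_k\}_{k<n}\rangle$ be profinite posets and $f:P\to H$ a continuous quotient map. Then there exist a strictly increasing sequence $(i_n)_{n\in\mathbb{N}}$ of natural numbers and quotient maps $g_j:P_{i_j}\to H_j$ such that $f(x_1,x_2,\dots)=(g_1(x_{i_1}),g_2(x_{i_2}),\dots)$ for all $(x_n)\in P$, and $g_k\circ p^{i_n}_{i_k}=h^n_k\circ g_n$ for all $k<n$.
   Context: A quotient map between posets is a surjective order-preserving map $\phi:A\to B$ such that for all $p\le r$ in $B$ there are $x\le y$ in $A$ with $\phi(x)=p,\phi(y)=r$. A profinite poset is an inverse limit $\{(x_n)\in\prod_n P_n:p^{n+1}_n(x_{n+1})=x_n\ \forall n\}$ of nonempty finite posets $P_n$ with quotient maps $p^m_k:P_m\to P_k$ ($k<m$) satisfying $p^k_l\circ p^m_k=p^m_l$, ordered coordinatewise and topologized as a subspace of the product of discrete spaces. -}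

module Defs where

open import Data.Fin.Base using (Fin)
open import Data.List.Relation.Unary.All using (All)
open import Data.Nat.Base using (ℕ; suc; _<_)
open import Data.Nat.Properties using (n<1+n; <-trans)
open import Data.Product.Base using (_×_; ∃-syntax; ∃₂)
open import Function.Base using (_∘_)
open import Function.Bundles using (Inverse)
open import Function.Definitions using (Surjective)
open import Level using (0ℓ) renaming (suc to lsuc)
open import Relation.Binary.Bundles using (Poset)
open import Relation.Binary.Morphism.Structures using (IsOrderHomomorphism)
open import Relation.Binary.PropositionalEquality.Properties using (setoid)
open import Relation.Unary using (Pred)

record IsQuotientMap (A B : Poset 0ℓ 0ℓ 0ℓ)
                     (φ : Poset.Carrier A → Poset.Carrier B) : Set where
  private
    module A = Poset A
    module B = Poset B
  field
    isOrderHomomorphism : IsOrderHomomorphism A._≈_ B._≈_ A._≤_ B._≤_ φ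
    surjective          : Surjective A._≈_ B._≈_ φ
    lift-≤              : ∀ {p r} → p B.≤ r →
                          ∃₂ λ x y → x A.≤ y × φ x B.≈ p × φ y B.≈ r

record FinitePoset : Set (lsuc 0ℓ) where
  field
    poset       : Poset 0ℓ 0ℓ 0ℓ
    size        : ℕ
    enumeration : Inverse (Poset.Eq.setoid poset) (setoid (Fin size))

  open Poset poset public

-- The maps p^m_k exist for k < m only; proofs of k < m are unique
-- (Data.Nat.Properties.<-irrelevant), so there is one map for each pair.
record InverseSequence : Set (lsuc 0ℓ) where
  field
    obj           : ℕ → FinitePoset

  module Obj (n : ℕ) = FinitePoset (obj n)

  field
    nonempty      : ∀ n → Obj.Carrier n
    bond          : ∀ {k m} → k < m → Obj.Carrier m → Obj.Carrier k
    isQuotientMap : ∀ {k m} (k<m : k < m) →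
                    IsQuotientMap (Obj.poset m) (Obj.poset k) (bond k<m)
    bond-∘        : ∀ {l k m} (l<k : l < k) (k<m : k < m) (x : Obj.Carrier m) →
                    Obj._≈_ l (bond l<k (bond k<m x)) (bond (<-trans l<k k<m) x)

module _ (P : InverseSequence) where
  open InverseSequence P

  record Point : Set where
    field
      coord      : ∀ n → Obj.Carrier n
      compatible : ∀ n → Obj._≈_ n (bond (n<1+n n) (coord (suc n))) (coord n)

  open Point

  -- Equality of points is equality of sequences, i.e. coordinatewise.
  limit : Poset 0ℓ 0ℓ 0ℓ
  limit = record
    { Carrier        = Point
    ; _≈_            = λ x y → ∀ n → Obj._≈_ n (coord x n) (coord y n)
    ; _≤_            = λ x y → ∀ n → Obj._≤_ n (coord x n) (coord y n)
    ; isPartialOrder = record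
      { isPreorder = record
        { isEquivalence = record
          { refl  = λ n → Obj.Eq.refl n
          ; sym   = λ x≈y n → Obj.Eq.sym n (x≈y n)
          ; trans = λ x≈y y≈z n → Obj.Eq.trans n (x≈y n) (y≈z n)
          }
        ; reflexive = λ x≈y n → Obj.reflexive n (x≈y n)
        ; trans     = λ x≤y y≤z n → Obj.trans n (x≤y n) (y≤z n)
        }
      ; antisym = λ x≤y y≤x n → Obj.antisym n (x≤y n) (y≤x n)
      }
    }

  -- The subspace topology from the product of discrete spaces: the basic
  -- neighbourhoods of x fix the coordinates of x at finitely many indices.
  -- An open set is in particular closed under the equality of points.
  Open : Pred Point 0ℓ → Set
  Open U = ∀ x → U x → ∃[ ns ] (∀ y →
    All (λ n → Obj._≈_ n (coord y n) (coord x n)) ns → U y)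

Continuous : (P H : InverseSequence) → (Point P → Point H) → Set (lsuc 0ℓ)
Continuous P H f = ∀ (U : Pred (Point H) 0ℓ) → Open H U → Open P (U ∘ f)

{-# OPTIONS --safe #-}

-- By König's lemma a locally constant map on P factors through some P_m: a
-- failure at every level would propagate along a thread of P, against local
-- constancy at the point which that thread defines. Each coordinate f_j is
-- locally constant, which gives the indices i_j. Since relations p ≤ r in P_n
-- lift to P, g_j (a) can be read off as f_j of any point above a, and the
-- properties of g_j are inherited from those of f.

module Submission where

open import Defs
open import Axiom.ExcludedMiddle using (ExcludedMiddle)
open import Data.Fin.Base using (Fin; zero; suc)
open import Data.List.Base using ([_])
open import Data.List.Extrema.Nat using (max; xs≤max)
open import Data.List.Relation.Unary.All as All using (All; _∷_)
open import Data.Nat.Base using (ℕ; zero; suc; _+_; _≤_; _<_; _⊔_; s≤s; s≤s⁻¹)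
open import Data.Nat.Properties
  using (≤-refl; <-trans; n<1+n; m≤n⇒m≤1+n; m≤m⊔n; m≤n⊔m; m≤m+n; m≤n+m;
         m<n⇒m<1+n; m≤n⇒m<n∨m≡n; <-irrelevant)
open import Data.Product.Base using (_×_; _,_; proj₁; proj₂; Σ-syntax; ∃-syntax)
open import Data.Sum.Base using (inj₁; inj₂)
open import Function.Base using (_∘_)
open import Function.Bundles using (Inverse)
open import Level using (0ℓ)
open import Relation.Binary.Core using (Rel; _Preserves_⟶_)
open import Relation.Binary.Definitions using (Symmetric; Transitive)
open import Relation.Binary.Morphism.Structures using (IsOrderHomomorphism)
open import Relation.Binary.PropositionalEquality.Core as ≡ using (refl)
open import Relation.Nullary.Decidable.Core using (yes; no; decidable-stable)
open import Relation.Nullary.Negation.Core using (¬_; contradiction)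

-- Strictly increasing majorants of sequences.

step-mono⇒mono : (i : ℕ → ℕ) → (∀ n → i n < i (suc n)) → i Preserves _<_ ⟶ _<_
step-mono⇒mono i step {k} {suc n} k<1+n with m≤n⇒m<n∨m≡n (s≤s⁻¹ k<1+n)
... | inj₁ k<n  = <-trans (step-mono⇒mono i step k<n) (step n)
... | inj₂ refl = step n

-- The levels supplied by compactness come in no particular order. The successor forces strict
-- growth while the maximum keeps each index at or beyond its required level.
dominating : (ℕ → ℕ) → ℕ → ℕ
dominating N zero    = N zero
dominating N (suc j) = suc (dominating N j ⊔ N (suc j))

dominating-mono : ∀ N → dominating N Preserves _<_ ⟶ _<_
dominating-mono N = step-mono⇒mono (dominating N) (λ j → s≤s (m≤m⊔n _ _))

≤-dominating : ∀ N j → N j ≤ dominating N j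
≤-dominating N zero    = ≤-refl
≤-dominating N (suc j) = m≤n⇒m≤1+n (m≤n⊔m (dominating N j) (N (suc j)))

-- Common bounds over finite sets.

UpwardClosed : ∀ {A : Set} → (A → ℕ → Set) → Set
UpwardClosed R = ∀ {a m n} → m ≤ n → R a m → R a n

Fin-uniform : ∀ {s} (R : Fin s → ℕ → Set) → UpwardClosed R →
              (∀ a → ∃[ m ] R a m) → ∃[ m ] (∀ a → R a m)
Fin-uniform {zero}  R up bound = 0 , λ ()
Fin-uniform {suc s} R up bound
  with bound zero | Fin-uniform (R ∘ suc) up (bound ∘ suc)
... | m , Rm | n , Rn = m ⊔ n , λ where
  zero    → up (m≤m⊔n m n) Rm
  (suc a) → up (m≤n⊔m m n) (Rn a)

module _ (A : FinitePoset) where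
  open FinitePoset A
  open Inverse enumeration using (to; from; strictlyInverseʳ)

  uniform : (R : Carrier → ℕ → Set) → UpwardClosed R →
            (∀ {a b m} → a ≈ b → R a m → R b m) →
            (∀ a → ∃[ m ] R a m) → ∃[ m ] (∀ a → R a m)
  uniform R up resp bound with Fin-uniform (R ∘ from) up (bound ∘ from)
  ... | m , Rm = m , λ a → resp (strictlyInverseʳ a) (Rm (to a))

-- Coordinates of points of an inverse limit.

module Limit (P : InverseSequence) where
  open InverseSequence P
  open Point

  bond-cong : ∀ {k m} (k<m : k < m) {a b} →
              Obj._≈_ m a b → Obj._≈_ k (bond k<m a) (bond k<m b)
  bond-cong k<m = IsOrderHomomorphism.cong
    (IsQuotientMap.isOrderHomomorphism (isQuotientMap k<m))

  bond-mono : ∀ {k m} (k<m : k < m) {a b} →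
              Obj._≤_ m a b → Obj._≤_ k (bond k<m a) (bond k<m b)
  bond-mono k<m = IsOrderHomomorphism.mono
    (IsQuotientMap.isOrderHomomorphism (isQuotientMap k<m))

  bond-irrelevant : ∀ {k m} (p q : k < m) a → Obj._≈_ k (bond p a) (bond q a)
  bond-irrelevant {k} p q a = Obj.Eq.reflexive k
    (≡.cong (λ r → bond r a) (<-irrelevant p q))

  bond-∘′ : ∀ {l k m} (l<k : l < k) (k<m : k < m) (l<m : l < m) a →
            Obj._≈_ l (bond l<k (bond k<m a)) (bond l<m a)
  bond-∘′ {l} l<k k<m l<m a =
    Obj.Eq.trans l (bond-∘ l<k k<m a) (bond-irrelevant _ l<m a)

  coord-bond : ∀ (x : Point P) {k m} (k<m : k < m) →
               Obj._≈_ k (bond k<m (coord x m)) (coord x k)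
  coord-bond x {k} {suc m} k<1+m with m≤n⇒m<n∨m≡n (s≤s⁻¹ k<1+m)
  ... | inj₁ k<m  = Obj.Eq.trans k
    (Obj.Eq.sym k (bond-∘′ k<m (n<1+n m) k<1+m _))
    (Obj.Eq.trans k (bond-cong k<m (compatible x m)) (coord-bond x k<m))
  ... | inj₂ refl = Obj.Eq.trans k
    (bond-irrelevant k<1+m (n<1+n k) _) (compatible x k)

  Agree : ℕ → Rel (Point P) 0ℓ
  Agree n x y = Obj._≈_ n (coord x n) (coord y n)

  Agree-down : ∀ {x y k m} → k ≤ m → Agree m x y → Agree k x y
  Agree-down {x} {y} {k} k≤m eq with m≤n⇒m<n∨m≡n k≤m
  ... | inj₁ k<m  = Obj.Eq.trans k (Obj.Eq.sym k (coord-bond x k<m))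
    (Obj.Eq.trans k (bond-cong k<m eq) (coord-bond y k<m))
  ... | inj₂ refl = eq

  -- Threads starting at a given level, and their points.

  record Thread (n : ℕ) : Set where
    field
      -- With `k + n` rather than `n + k`, the level of `node (suc k)` reduces to `suc (k + n)`.
      node : ∀ k → Obj.Carrier (k + n)
      link : ∀ k → Obj._≈_ (k + n) (bond (n<1+n (k + n)) (node (suc k))) (node k)

  open Thread

  k<1+k+n : ∀ k n → k < suc (k + n)
  k<1+k+n k n = s≤s (m≤m+n k n)

  -- The k-th coordinate is taken from level 1 + k + n, which exceeds k
  -- whether or not k < n.
  threadPoint : ∀ {n} → Thread n → Point P
  threadPoint {n} t = record
    { coord      = λ k → bond (k<1+k+n k n) (node t (suc k))
    ; compatible = λ k → let open Obj.Eq k in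
        trans (bond-∘′ _ _ (m<n⇒m<1+n (k<1+k+n k n)) _)
        (trans (sym (bond-∘′ (k<1+k+n k n) (n<1+n _) _ _))
               (bond-cong (k<1+k+n k n) (link t (suc k))))
    }

  -- Induction on `k` removes the top `link`. The case `k = n` is the one that identifies coordinate
  -- `n` of `threadPoint t`.
  bond-node : ∀ {n} (t : Thread n) k (n<1+k+n : n < suc k + n) →
              Obj._≈_ n (bond n<1+k+n (node t (suc k))) (node t 0)
  bond-node {n} t zero    n<m =
    Obj.Eq.trans n (bond-irrelevant n<m (n<1+n n) _) (link t 0)
  bond-node {n} t (suc k) n<m = let open Obj.Eq n in
    trans (sym (bond-∘′ n<1+k+n (n<1+n _) n<m _))
    (trans (bond-cong n<1+k+n (link t (suc k))) (bond-node t k n<1+k+n))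
    where
    n<1+k+n : n < suc k + n
    n<1+k+n = s≤s (m≤n+m n k)

  threadPoint-base : ∀ {n} (t : Thread n) →
                     Obj._≈_ n (coord (threadPoint t) n) (node t 0)
  threadPoint-base {n} t = bond-node t n (k<1+k+n n n)

  -- Lifting relations from a finite level to the limit.

  module _ {n : ℕ} {a b : Obj.Carrier n} (a≤b : Obj._≤_ n a b) where

    -- Both ends are lifted together, since separately chosen preimages need not be comparable.
    ascend : ∀ k → ∃[ p ] ∃[ q ] Obj._≤_ (k + n) p q
    ascend zero    = a , b , a≤b
    ascend (suc k) with IsQuotientMap.lift-≤ (isQuotientMap (n<1+n (k + n)))
                          (proj₂ (proj₂ (ascend k)))
    ... | p , q , p≤q , _ = p , q , p≤q

    lowerThread upperThread : Thread n
    lowerThread = record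
      { node = λ k → proj₁ (ascend k)
      ; link = λ k → proj₁ (proj₂ (proj₂ (proj₂
          (IsQuotientMap.lift-≤ (isQuotientMap (n<1+n (k + n)))
            (proj₂ (proj₂ (ascend k)))))))
      }
    upperThread = record
      { node = λ k → proj₁ (proj₂ (ascend k))
      ; link = λ k → proj₂ (proj₂ (proj₂ (proj₂
          (IsQuotientMap.lift-≤ (isQuotientMap (n<1+n (k + n)))
            (proj₂ (proj₂ (ascend k)))))))
      }

    lower upper : Point P
    lower = threadPoint lowerThread
    upper = threadPoint upperThread

    lower≤upper : ∀ k → Obj._≤_ k (coord lower k) (coord upper k)
    lower≤upper k = bond-mono (k<1+k+n k n) (proj₂ (proj₂ (ascend (suc k))))

    lower-coord : Obj._≈_ n (coord lower n) a
    lower-coord = threadPoint-base lowerThread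

    upper-coord : Obj._≈_ n (coord upper n) b
    upper-coord = threadPoint-base upperThread

  pointAbove : ∀ {n} → Obj.Carrier n → Point P
  pointAbove {n} a = lower (Obj.refl n {a})

  pointAbove-coord : ∀ {n} (a : Obj.Carrier n) →
                     Obj._≈_ n (coord (pointAbove a) n) a
  pointAbove-coord {n} a = lower-coord (Obj.refl n {a})

  -- Compactness by König's lemma.

  module Compactness (em : ExcludedMiddle 0ℓ)
    (_~_ : Rel (Point P) 0ℓ) (~-sym : Symmetric _~_) (~-trans : Transitive _~_)
    (locally : ∀ x → ∃[ ns ] (∀ y → All (λ n → Agree n y x) ns → y ~ x))
    where

    -- Only `x` is placed over `a`; once `n ≤ m`, agreement at `m` places `y` there too.
    DeterminedBy : ∀ n → Obj.Carrier n → ℕ → Set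
    DeterminedBy n a m = ∀ x y → Obj._≈_ n (coord x n) a → Agree m x y → x ~ y

    Good : ∀ n → Obj.Carrier n → Set
    Good n a = ∃[ m ] DeterminedBy n a m

    DeterminedBy-up : ∀ {n} → UpwardClosed (DeterminedBy n)
    DeterminedBy-up m≤m′ det x y x∈a eq =
      det x y x∈a (Agree-down {x} {y} m≤m′ eq)

    DeterminedBy-resp : ∀ {n a b m} → Obj._≈_ n a b →
                        DeterminedBy n a m → DeterminedBy n b m
    DeterminedBy-resp {n} a≈b det x y x∈b =
      det x y (Obj.Eq.trans n x∈b (Obj.Eq.sym n a≈b))

    -- Every point over `b` also lies over its image, so the same bound serves.
    Good-bond : ∀ {k n} (k<n : k < n) b → Good k (bond k<n b) → Good n b
    Good-bond {k} k<n b (m , det) = m , λ x y x∈b → det x y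
      (Obj.Eq.trans k (Obj.Eq.sym k (coord-bond x k<n)) (bond-cong k<n x∈b))

    Good-coord : ∀ x → ∃[ m ] Good m (coord x m)
    Good-coord x with locally x
    -- One `m`, the largest index in `ns`, is both the level and the bound: `y` and `z` then share
    -- coordinate `m` with `x`, so both lie in its neighbourhood. The 0 covers an empty `ns`.
    ... | ns , nbhd = m , m , λ y z y∈x y~z → ~-trans (near y y∈x)
        (~-sym (near z (Obj.Eq.trans m (Obj.Eq.sym m y~z) y∈x)))
      where
      m : ℕ
      m = max 0 ns
      near : ∀ y → Agree m y x → y ~ x
      near y eq = nbhd y
        (All.map (λ n≤m → Agree-down {y} {x} n≤m eq) (xs≤max 0 ns))

    BadExtension : ∀ n → Obj.Carrier n → Set
    BadExtension n a =
      ∃[ b ] Obj._≈_ n (bond (n<1+n n) b) a × ¬ Good (suc n) b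

    -- If every extension of `a` were good, their finitely many bounds would have a common one,
    -- making `a` good.
    bad-extends : ∀ {n a} → ¬ Good n a → BadExtension n a
    bad-extends {n} {a} bad = decidable-stable em λ none →
      let (m , det) = uniform (obj (suc n)) R
            (λ m≤m′ r b∈a → DeterminedBy-up m≤m′ (r b∈a))
            (λ b≈c r c∈a → DeterminedBy-resp b≈c
              (r (Obj.Eq.trans n (bond-cong (n<1+n n) b≈c) c∈a)))
            (bound none)
      -- A point over `a` has its next coordinate among the extensions of `a`.
      in bad (m , λ x y x∈a → det (coord x (suc n))
           (Obj.Eq.trans n (compatible x n) x∈a) x y (Obj.Eq.refl (suc n)))
      where
      R : Obj.Carrier (suc n) → ℕ → Set
      -- The premise makes `R` vacuous off the fibre of `a`, so `uniform` can range over the whole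
      -- level.
      R b m = Obj._≈_ n (bond (n<1+n n) b) a → DeterminedBy (suc n) b m
      bound : ¬ BadExtension n a → ∀ b → ∃[ m ] R b m
      bound none b with em {Good (suc n) b}
      ... | yes (m , det) = m , λ _ → det
      ... | no  ¬good     = 0 , λ b∈a → contradiction (b , b∈a , ¬good) none

    module _ {n a} (bad : ¬ Good n a) where

      badNode : ∀ k → ∃[ b ] ¬ Good (k + n) b
      badNode zero    = a , bad
      badNode (suc k) with bad-extends (proj₂ (badNode k))
      ... | b , _ , ¬good = b , ¬good

      badThread : Thread n
      badThread = record
        { node = λ k → proj₁ (badNode k)
        ; link = λ k → proj₁ (proj₂ (bad-extends (proj₂ (badNode k))))
        }

    good : ∀ n a → Good n a
    good n a = decidable-stable em λ bad →
      let (m , g) = Good-coord (threadPoint (badThread bad)) in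
      -- Coordinate `m` of the thread's point is by definition the image of this bad node, so its
      -- goodness would pass up to the node.
      proj₂ (badNode bad (suc m)) (Good-bond (k<1+k+n m n) _ g)

    lebesgue : ∃[ m ] (∀ x y → Agree m x y → x ~ y)
    -- Level 0 is finite and every point lies over one of its elements.
    lebesgue with uniform (obj 0) (DeterminedBy 0) DeterminedBy-up
                    DeterminedBy-resp (good 0)
    ... | m , det = m , λ x y → det (coord x 0) x y (Obj.Eq.refl 0)

-- Factoring the coordinates of `f` through finite levels.

module Factorisation (P H : InverseSequence) (f : Point P → Point H)
  (f-quotient : IsQuotientMap (limit P) (limit H) f)
  where
  private
    module P = InverseSequence P
    module H = InverseSequence H
    module LP = Limit P
    module LH = Limit H
    module f where
      open IsQuotientMap f-quotient public
      open IsOrderHomomorphism isOrderHomomorphism public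
  open Point

  _~[_]_ : Point P → ℕ → Point P → Set
  x ~[ j ] y = H.Obj._≈_ j (coord (f x) j) (coord (f y) j)

  locallyConstant : Continuous P H f → ∀ j x →
    ∃[ ns ] (∀ y → All (λ n → LP.Agree n y x) ns → y ~[ j ] x)
  -- `U` is the cylinder of points sharing coordinate `j` with `f x`; its preimage is open and
  -- contains `x`.
  locallyConstant cont j x = cont U U-open x (H.Obj.Eq.refl j)
    where
    U : Point H → Set
    U z = H.Obj._≈_ j (coord z j) (coord (f x) j)
    U-open : Open H U
    U-open z z∈U = [ j ] , λ { w (w≈z ∷ _) → H.Obj.Eq.trans j w≈z z∈U }

  factor : ∀ m j → P.Obj.Carrier m → H.Obj.Carrier j
  factor m j a = coord (f (LP.pointAbove a)) j

  module _ {m j} (determines : ∀ x y → LP.Agree m x y → x ~[ j ] y) where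

    factor-above : ∀ {a} x → P.Obj._≈_ m (coord x m) a →
                   H.Obj._≈_ j (coord (f x) j) (factor m j a)
    factor-above {a} x x∈a = determines x (LP.pointAbove a)
      (P.Obj.Eq.trans m x∈a (P.Obj.Eq.sym m (LP.pointAbove-coord a)))

    factor-cong : ∀ {a b} → P.Obj._≈_ m a b →
                  H.Obj._≈_ j (factor m j a) (factor m j b)
    factor-cong {a} a≈b = factor-above (LP.pointAbove a)
      (P.Obj.Eq.trans m (LP.pointAbove-coord a) a≈b)

    factor-coord : ∀ x → H.Obj._≈_ j (coord (f x) j) (factor m j (coord x m))
    factor-coord x = factor-above x (P.Obj.Eq.refl m)

    -- The points that `factor` picks over `a` and `b` need not be comparable; `factor-above`
    -- exchanges them for `lower` and `upper`, which are.
    factor-mono : ∀ {a b} → P.Obj._≤_ m a b →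
                  H.Obj._≤_ j (factor m j a) (factor m j b)
    factor-mono a≤b = H.Obj.trans j
      (H.Obj.reflexive j (H.Obj.Eq.sym j
        (factor-above (LP.lower a≤b) (LP.lower-coord a≤b))))
      (H.Obj.trans j (f.mono {LP.lower a≤b} {LP.upper a≤b} (LP.lower≤upper a≤b) j)
        (H.Obj.reflexive j
          (factor-above (LP.upper a≤b) (LP.upper-coord a≤b))))

    factor-isQuotientMap :
      IsQuotientMap (P.Obj.poset m) (H.Obj.poset j) (factor m j)
    factor-isQuotientMap = record
      { isOrderHomomorphism = record { cong = factor-cong ; mono = factor-mono }
      -- Raise `c` to a point of the limit of `H`, take a preimage under `f`, and project it to
      -- level `m`.
      ; surjective = λ c →
          let (x , fx≈) = f.surjective (LH.pointAbove c) in
          coord x m , λ a≈x → H.Obj.Eq.trans j (factor-cong a≈x)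
            (over x (LH.pointAbove c) (fx≈ {x} (λ n → P.Obj.Eq.refl n))
              (LH.pointAbove-coord c))
      ; lift-≤ = λ p≤r →
          let
            z = LH.lower p≤r
            w = LH.upper p≤r
            (x , y , x≤y , fx≈z , fy≈w) = f.lift-≤ {z} {w} (LH.lower≤upper p≤r)
          in
          coord x m , coord y m , x≤y m ,
          over x z fx≈z (LH.lower-coord p≤r) , over y w fy≈w (LH.upper-coord p≤r)
      }
      where
      over : ∀ x z {c} → (∀ n → LH.Agree n (f x) z) →
             H.Obj._≈_ j (coord z j) c → H.Obj._≈_ j (factor m j (coord x m)) c
      over x z fx≈z z∈c = H.Obj.Eq.trans j (H.Obj.Eq.sym j (factor-coord x))
        (H.Obj.Eq.trans j (fx≈z j) z∈c)

  -- Both sides come from one point `x` over `a`: it also lies over `P.bond l<m a`, so the left side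
  -- is coordinate `k` of `f x`, while `factor m n a` is its coordinate `n` by definition.
  factor-natural : ∀ {l m k n} →
    (∀ x y → LP.Agree l x y → x ~[ k ] y) → (l<m : l < m) (k<n : k < n) →
    ∀ a → H.Obj._≈_ k (factor l k (P.bond l<m a)) (H.bond k<n (factor m n a))
  factor-natural {l} {k = k} det l<m k<n a = H.Obj.Eq.trans k
    (H.Obj.Eq.sym k (factor-above det x
      (P.Obj.Eq.trans l (P.Obj.Eq.sym l (LP.coord-bond x l<m))
        (LP.bond-cong l<m (LP.pointAbove-coord a)))))
    (H.Obj.Eq.sym k (LH.coord-bond (f x) k<n))
    where
    x : Point P
    x = LP.pointAbove a

-- Choice of the indices and assembly.

mainTheorem7 : ExcludedMiddle 0ℓ →
    (P H : InverseSequence) →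
    let module P = InverseSequence P
        module H = InverseSequence H in
    (f : Point P → Point H) →
    IsQuotientMap (limit P) (limit H) f →
    Continuous P H f →
    Σ[ i ∈ (ℕ → ℕ) ]
    Σ[ i-mono ∈ (∀ {k n} → k < n → i k < i n) ]
    Σ[ g ∈ (∀ j → P.Obj.Carrier (i j) → H.Obj.Carrier j) ]
      (∀ j → IsQuotientMap (P.Obj.poset (i j)) (H.Obj.poset j) (g j))
      × (∀ (x : Point P) j →
           H.Obj._≈_ j (Point.coord (f x) j) (g j (Point.coord x (i j))))
      × (∀ {k n} (k<n : k < n) (a : P.Obj.Carrier (i n)) →
           H.Obj._≈_ k (g k (P.bond (i-mono k<n) a)) (H.bond k<n (g n a)))
mainTheorem7 em P H f f-quotient f-continuous =
  i , i-mono , (λ j → factor (i j) j) ,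
  (λ j → factor-isQuotientMap (determines j)) ,
  (λ x j → factor-coord (determines j) x) ,
  (λ {k} k<n → factor-natural (determines k) (i-mono k<n) k<n)
  where
  open Factorisation P H f f-quotient
  module LP = Limit P
  module H = InverseSequence H

  level : ∀ j → ∃[ m ] (∀ x y → LP.Agree m x y → x ~[ j ] y)
  level j = LP.Compactness.lebesgue em (_~[ j ]_)
    (H.Obj.Eq.sym j) (H.Obj.Eq.trans j) (locallyConstant f-continuous j)

  i : ℕ → ℕ
  i = dominating (proj₁ ∘ level)

  i-mono : ∀ {k n} → k < n → i k < i n
  i-mono = dominating-mono (proj₁ ∘ level)

  determines : ∀ j x y → LP.Agree (i j) x y → x ~[ j ] y
  determines j x y eq = proj₂ (level j) x y
    (LP.Agree-down {x} {y} (≤-dominating (proj₁ ∘ level) j) eq)
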